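{- Let $W$ be a Coxeter group, let $\equiv$ be an essential semilattice congruence on the left weak order of $W$, and let $\mathbf S_\equiv:W\to W$ be the associated Coxeter stack-sorting operator. If $v,w\in W$ are such that $v\leq_L w$, then $\lvert\mathbf S_\equiv^{ -1}(v)\rvert\geq\lvert\mathbf S_\equiv^{ -1}(w)\rvert$.
   Context: Let $(W,S)$ be a Coxeter system with length function $\ell$ and identity $e$. The left weak order is $x\leq_L y\iff\ell(yx^{ -1})=\ell(y)-\ell(x)$; it is a locally finite meet-semilattice with minimum $e$ (Björner). A semilattice congruence on it is an equivalence relation $\equiv$ such that $x_1\equiv x_2$ and $y_1\equiv y_2$ imply $x_1\wedge y_1\equiv x_2\wedge y_2$. It is essential if $\{e\}$ is a congruence class. Every class has a unique minimal element; $\pi_\downarrow^\equiv(w)$ denotes the minimal element of the class of $w$. The Coxeter stack-sorting operator is $\mathbf S_\equiv(w)=w\,(\pi_\downarrow^\equiv(w))^{ -1}$. $\lvert\cdot\rvert$ denotes cardinality. -}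

module Defs where

open import Algebra.Bundles using (Group)
open import Algebra.Core using (Op₁; Op₂)
open import Algebra.Definitions using (Congruent₂)
open import Data.Integer.Base using (+_; _⊖_)
open import Data.List.Base using (List; []; _∷_; _++_; foldr; length; concat; replicate)
open import Data.Nat.Base using (ℕ; _≤_)
open import Data.Product.Base using (_×_; ∃-syntax; proj₁)
open import Function.Bundles using (_⇔_; Injection)
open import Level using (Level; suc; _⊔_)
open import Relation.Binary.Bundles using (Setoid)
open import Relation.Binary.Core using (Rel; _⇒_)
open import Relation.Binary.Structures using (IsEquivalence)
open import Relation.Binary.PropositionalEquality.Core using (_≡_)
open import Relation.Binary.Construct.Closure.Equivalence using (EqClosure)
import Relation.Binary.Construct.On as On

private
  variable
    a b c e s r : Level

-- The entry m s t = 0 encodes m(s,t) = ∞.  By m≡1⇔≡, an off-diagonal entry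
-- is either 0 or at least 2.
record CoxeterMatrix (S : Set s) : Set s where
  field
    m       : S → S → ℕ
    m-sym   : ∀ x y → m x y ≡ m y x
    m≡1⇔≡ : ∀ x y → (m x y ≡ 1) ⇔ (x ≡ y)

  relator : S → S → List S
  relator x y = concat (replicate (m x y) (x ∷ y ∷ []))

  -- As relator x x = x ∷ x ∷ [], every generator is its own inverse, so words
  -- without formal inverses suffice for the group presentation.
  data _⟶_ : Rel (List S) s where
    delete : ∀ p x y q → (p ++ relator x y ++ q) ⟶ (p ++ q)

  _≃_ : Rel (List S) s
  _≃_ = EqClosure _⟶_

-- The fields surjective and presents say that W is the group presented by
-- ⟨ S ∣ (x y)^m(x,y) = 1 ⟩.
record CoxeterSystem (c e s : Level) : Set (suc (c ⊔ e ⊔ s)) where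
  field
    W      : Group c e
    S      : Set s
    matrix : CoxeterMatrix S
    simple : S → Group.Carrier W

  open Group W public
  open CoxeterMatrix matrix public

  ⟦_⟧ : List S → Carrier
  ⟦_⟧ = foldr (λ x w → simple x ∙ w) ε

  field
    surjective : ∀ w → ∃[ p ] ⟦ p ⟧ ≈ w
    presents   : ∀ p q → (⟦ p ⟧ ≈ ⟦ q ⟧) ⇔ (p ≃ q)

module _ (C : CoxeterSystem c e s) where
  open CoxeterSystem C

  -- ℓ w is the least length of a word representing w.
  record IsLengthFunction (ℓ : Carrier → ℕ) : Set (c ⊔ e ⊔ s) where
    field
      attained : ∀ w → ∃[ p ] (⟦ p ⟧ ≈ w × length p ≡ ℓ w)
      minimal  : ∀ w p → ⟦ p ⟧ ≈ w → ℓ w ≤ length p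

  -- The difference of lengths is taken in ℤ.
  LeftWeakOrder : (Carrier → ℕ) → Rel Carrier _
  LeftWeakOrder ℓ x y = + ℓ (y ∙ x ⁻¹) ≡ ℓ y ⊖ ℓ x

  record IsSemilatticeCongruence (_∧_ : Op₂ Carrier) (_∼_ : Rel Carrier r)
         : Set (c ⊔ e ⊔ r) where
    field
      isEquivalence : IsEquivalence _∼_
      ≈⇒∼          : _≈_ ⇒ _∼_
      ∧-cong        : Congruent₂ _∼_ _∧_

  IsEssential : Rel Carrier r → Set _
  IsEssential _∼_ = ∀ w → w ∼ ε → w ≈ ε

  record IsMinimalInClass (_≤L_ : Rel Carrier a) (_∼_ : Rel Carrier r)
         (w u : Carrier) : Set (a ⊔ c ⊔ e ⊔ r) where
    field
      inClass : u ∼ w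
      minimal : ∀ x → x ∼ w → x ≤L u → x ≈ u

  stackSort : Op₁ Carrier → Op₁ Carrier
  stackSort π↓ w = w ∙ π↓ w ⁻¹

  Preimage : Op₁ Carrier → Carrier → Setoid _ _
  Preimage f v = On.setoid {B = ∃[ x ] f x ≈ v} setoid proj₁

-- Comparison of cardinalities, for possibly infinite sets.
∣_∣≥∣_∣ : ∀ {a₁ a₂ b₁ b₂} → Setoid a₁ a₂ → Setoid b₁ b₂ → Set _
∣ A ∣≥∣ B ∣ = Injection B A

{-# OPTIONS --safe #-}
-- The injection sends x = w ∙ π↓ x in the fibre of w to v ∙ π↓ x.  Writing
-- w = a ∙ v with lengths adding, x = a ∙ v ∙ π↓ x is length-additive as well,
-- so v ∙ π↓ x lies between π↓ x and x in the left weak order.  Classes of a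
-- semilattice congruence are convex, hence v ∙ π↓ x is congruent to π↓ x and
-- has the same minimal class representative.
module Submission where

open import Defs
open import Algebra.Core using (Op₁; Op₂)
open import Data.Nat.Base using (ℕ)
open import Relation.Binary.Core using (Rel)
open import Relation.Binary.Lattice.Definitions using (Infimum)

open import Data.Integer.Base as ℤ using (_⊖_) renaming (+_ to pos)
import Data.Integer.Properties as ℤ
open import Data.List.Base using ([]; _∷_; _++_; length)
open import Data.List.Properties using (length-++)
open import Data.Nat.Base using (_+_; _≤_)
open import Data.Nat.Properties
  using (≤-antisym; ≤-trans; ≤-reflexive; m≤n+m; n≤0⇒n≡0; +-assoc;
         +-cancelʳ-≡; +-cancelˡ-≤; module ≤-Reasoning)
open import Data.Product.Base using (_,_; proj₁; proj₂)
open import Function.Bundles using (Injection; _⇔_; mk⇔; Equivalence)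
open import Relation.Binary.Definitions using (Reflexive; Antisymmetric)
open import Relation.Binary.PropositionalEquality as ≡ using (_≡_)
open import Relation.Binary.Structures using (IsEquivalence)
import Algebra.Properties.Group as GroupProperties
import Relation.Binary.Reasoning.Setoid as SetoidReasoning

-- Trades the integer difference in `LeftWeakOrder` for an equation in `ℕ`, so that all later length
-- arithmetic avoids subtraction.
k≡m⊖n⇔k+n≡m : ∀ k m n → (pos k ≡ m ⊖ n) ⇔ (k + n ≡ m)
k≡m⊖n⇔k+n≡m k m n = mk⇔ to from
  where
  to : pos k ≡ m ⊖ n → k + n ≡ m
  to eq = ℤ.+-injective (begin
    pos k ℤ.+ pos n                 ≡⟨ ≡.cong (ℤ._+ pos n) (≡.trans eq (≡.sym (ℤ.m-n≡m⊖n m n))) ⟩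
    pos m ℤ.- pos n ℤ.+ pos n       ≡⟨ ℤ.+-assoc (pos m) (ℤ.- pos n) (pos n) ⟩
    pos m ℤ.+ (ℤ.- pos n ℤ.+ pos n) ≡⟨ ≡.cong (ℤ._+_ (pos m)) (ℤ.+-inverseˡ (pos n)) ⟩
    pos m ℤ.+ pos 0                 ≡⟨ ℤ.+-identityʳ (pos m) ⟩
    pos m                           ∎)
    where open ≡.≡-Reasoning

  from : k + n ≡ m → pos k ≡ m ⊖ n
  from ≡.refl = begin
    pos k             ≡⟨ ℤ.+-identityʳ (pos k) ⟨
    pos k ℤ.+ pos 0   ≡⟨ ≡.cong (ℤ._+_ (pos k)) (ℤ.n⊖n≡0 n) ⟨
    pos k ℤ.+ (n ⊖ n) ≡⟨ ℤ.distribʳ-⊖-+-pos k n n ⟩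
    (k + n) ⊖ n       ∎
    where open ≡.≡-Reasoning

module Length {c e s} (C : CoxeterSystem c e s) (ℓ : CoxeterSystem.Carrier C → ℕ)
              (isLength : IsLengthFunction C ℓ) where
  open CoxeterSystem C
  open IsLengthFunction isLength
  open GroupProperties W public
    using (x∙y⁻¹≈ε⇒x≈y; //-rightDividesˡ; //-rightDividesʳ; ∙-cancelˡ)

  infix 4 _≤L_
  _≤L_ : Rel Carrier _
  _≤L_ = LeftWeakOrder C ℓ

  ⟦⟧-homo-++ : ∀ p q → ⟦ p ++ q ⟧ ≈ ⟦ p ⟧ ∙ ⟦ q ⟧
  ⟦⟧-homo-++ []      q = sym (identityˡ ⟦ q ⟧)
  ⟦⟧-homo-++ (x ∷ p) q = trans (∙-congˡ (⟦⟧-homo-++ p q)) (sym (assoc (simple x) ⟦ p ⟧ ⟦ q ⟧))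

  -- `IsLengthFunction` does not postulate compatibility with `≈`; it follows because equal elements
  -- are represented by the same words.
  ℓ-cong : ∀ {x y} → x ≈ y → ℓ x ≡ ℓ y
  ℓ-cong x≈y = ≤-antisym (ℓ-mono x≈y) (ℓ-mono (sym x≈y))
    where
    ℓ-mono : ∀ {x y} → x ≈ y → ℓ x ≤ ℓ y
    ℓ-mono {x} {y} x≈y with attained y
    ... | p , ⟦p⟧≈y , ∣p∣≡ℓy = ≤-trans (minimal x p (trans ⟦p⟧≈y (sym x≈y))) (≤-reflexive ∣p∣≡ℓy)

  ℓ-ε : ℓ ε ≡ 0
  ℓ-ε = n≤0⇒n≡0 (minimal ε [] refl)

  ℓ≡0⇒≈ε : ∀ x → ℓ x ≡ 0 → x ≈ ε
  ℓ≡0⇒≈ε x ℓx≡0 with attained x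
  ... | []    , ε≈x , _     = sym ε≈x
  ... | _ ∷ _ , _   , ∣p∣≡ℓx with () ← ≡.trans ∣p∣≡ℓx ℓx≡0

  ℓ-subadditive : ∀ x y → ℓ (x ∙ y) ≤ ℓ x + ℓ y
  ℓ-subadditive x y with attained x | attained y
  ... | p , ⟦p⟧≈x , ∣p∣≡ℓx | q , ⟦q⟧≈y , ∣q∣≡ℓy = begin
    ℓ (x ∙ y)           ≤⟨ minimal (x ∙ y) (p ++ q) (trans (⟦⟧-homo-++ p q) (∙-cong ⟦p⟧≈x ⟦q⟧≈y)) ⟩
    length (p ++ q)     ≡⟨ length-++ p ⟩
    length p + length q ≡⟨ ≡.cong₂ _+_ ∣p∣≡ℓx ∣q∣≡ℓy ⟩
    ℓ x + ℓ y           ∎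
    where open ≤-Reasoning

  -- Any `z` with `z ∙ x ≈ y` can stand in for `y ∙ x ⁻¹`, so the order becomes length-additivity of
  -- a factorization, with no inverses.
  factor-≤L : ∀ {x y z} → z ∙ x ≈ y → (x ≤L y) ⇔ (ℓ z + ℓ x ≡ ℓ y)
  factor-≤L {x} {y} {z} zx≈y =
    ≡.subst (λ k → (x ≤L y) ⇔ (k + ℓ x ≡ ℓ y)) (ℓ-cong y∙x⁻¹≈z)
            (k≡m⊖n⇔k+n≡m (ℓ (y ∙ x ⁻¹)) (ℓ y) (ℓ x))
    where
    y∙x⁻¹≈z : y ∙ x ⁻¹ ≈ z
    y∙x⁻¹≈z = trans (∙-congʳ (sym zx≈y)) (//-rightDividesʳ x z)

  module _ {x y z : Carrier} (zx≈y : z ∙ x ≈ y) where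
    open Equivalence (factor-≤L zx≈y) public using ()
      renaming (to to ≤L⇒additive; from to additive⇒≤L)

  ≤L-refl : Reflexive _≤L_
  ≤L-refl {x} = additive⇒≤L (identityˡ x) (≡.cong (_+ ℓ x) ℓ-ε)

  ≤L⇒ℓ≤ : ∀ {x y} → x ≤L y → ℓ x ≤ ℓ y
  ≤L⇒ℓ≤ {x} {y} x≤y =
    ≤-trans (m≤n+m (ℓ x) (ℓ (y ∙ x ⁻¹))) (≤-reflexive (≤L⇒additive (//-rightDividesˡ x y) x≤y))

  -- The two relations force equal lengths, so the quotient `y ∙ x ⁻¹` has length 0, which only the
  -- empty word attains.
  ≤L-antisym : Antisymmetric _≈_ _≤L_
  ≤L-antisym {x} {y} x≤y y≤x = sym (x∙y⁻¹≈ε⇒x≈y y x (ℓ≡0⇒≈ε (y ∙ x ⁻¹) ℓy//x≡0))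
    where
    ℓy//x≡0 : ℓ (y ∙ x ⁻¹) ≡ 0
    ℓy//x≡0 = +-cancelʳ-≡ (ℓ x) _ 0
      (≡.trans (≤L⇒additive (//-rightDividesˡ x y) x≤y) (≤-antisym (≤L⇒ℓ≤ y≤x) (≤L⇒ℓ≤ x≤y)))

  ≤L-respˡ-≈ : ∀ {x y z} → x ≈ y → x ≤L z → y ≤L z
  ≤L-respˡ-≈ {x} {y} {z} x≈y x≤z = additive⇒≤L
    (trans (∙-congˡ (sym x≈y)) (//-rightDividesˡ x z))
    (≡.trans (≡.cong (ℓ (z ∙ x ⁻¹) +_) (ℓ-cong (sym x≈y))) (≤L⇒additive (//-rightDividesˡ x z) x≤z))

  module _ {a b c : Carrier} (additive : ℓ a + (ℓ b + ℓ c) ≡ ℓ (a ∙ (b ∙ c))) where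
    -- A loss of length in `b ∙ c` could not be regained by multiplying with `a`: bound the full
    -- product by `ℓ a + ℓ (b ∙ c)` and cancel `ℓ a`.
    additive-suffix : ℓ b + ℓ c ≡ ℓ (b ∙ c)
    additive-suffix = ≤-antisym
      (+-cancelˡ-≤ (ℓ a) _ _ (≤-trans (≤-reflexive additive) (ℓ-subadditive a (b ∙ c))))
      (ℓ-subadditive b c)

    additive⇒suffix≤L : c ≤L b ∙ c
    additive⇒suffix≤L = additive⇒≤L refl additive-suffix

    additive⇒suffix∙≤L : b ∙ c ≤L a ∙ (b ∙ c)
    additive⇒suffix∙≤L = additive⇒≤L refl (≡.trans (≡.cong (ℓ a +_) (≡.sym additive-suffix)) additive)

module Congruence
  {c e s r} (C : CoxeterSystem c e s) (ℓ : CoxeterSystem.Carrier C → ℕ)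
  (isLength : IsLengthFunction C ℓ)
  (_∧_ : Op₂ (CoxeterSystem.Carrier C)) (infimum : Infimum (LeftWeakOrder C ℓ) _∧_)
  (_∼_ : Rel (CoxeterSystem.Carrier C) r) (isCongruence : IsSemilatticeCongruence C _∧_ _∼_)
  (π↓ : Op₁ (CoxeterSystem.Carrier C))
  (π↓-minimal : ∀ w → IsMinimalInClass C (LeftWeakOrder C ℓ) _∼_ w (π↓ w))
  where
  open CoxeterSystem C
  open Length C ℓ isLength
  open IsSemilatticeCongruence isCongruence using (≈⇒∼; ∧-cong)
  private
    module ∼ = IsEquivalence (IsSemilatticeCongruence.isEquivalence isCongruence)
    module π↓ (w : Carrier) = IsMinimalInClass (π↓-minimal w)

  𝐒 : Op₁ Carrier
  𝐒 = stackSort C π↓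

  ∧-lowerˡ : ∀ x y → x ∧ y ≤L x
  ∧-lowerˡ x y = proj₁ (infimum x y)

  ∧-lowerʳ : ∀ x y → x ∧ y ≤L y
  ∧-lowerʳ x y = proj₁ (proj₂ (infimum x y))

  x≤Ly⇒x∧y≈x : ∀ {x y} → x ≤L y → x ∧ y ≈ x
  x≤Ly⇒x∧y≈x {x} {y} x≤y = ≤L-antisym (∧-lowerˡ x y) (proj₂ (proj₂ (infimum x y)) x ≤L-refl x≤y)

  ∧-idem : ∀ x → x ∧ x ≈ x
  ∧-idem x = x≤Ly⇒x∧y≈x ≤L-refl

  ∧-inClass : ∀ {x y z} → x ∼ z → y ∼ z → (x ∧ y) ∼ z
  ∧-inClass {z = z} x∼z y∼z = ∼.trans (∧-cong x∼z y∼z) (≈⇒∼ (∧-idem z))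

  -- Meet both sides of `x ∼ z` with `y`: the left side becomes `x`, the right side becomes `y`.
  class-convex : ∀ {x y z} → x ≤L y → y ≤L z → x ∼ z → x ∼ y
  class-convex x≤y y≤z x∼z =
    ∼.trans (∼.sym (≈⇒∼ (x≤Ly⇒x∧y≈x x≤y)))
    (∼.trans (∧-cong x∼z ∼.refl)
             (≈⇒∼ (≤L-antisym (∧-lowerʳ _ _) (proj₂ (proj₂ (infimum _ _)) _ y≤z ≤L-refl))))

  -- `IsMinimalInClass` only excludes class members strictly below `π↓ x`. Closure of the class
  -- under meets makes the minimal element least: `π↓ x ∧ y` is in the class and below `π↓ x`, hence
  -- equal to it.
  π↓-lower : ∀ {x y} → y ∼ x → π↓ x ≤L y
  π↓-lower {x} {y} y∼x =
    ≤L-respˡ-≈ (π↓.minimal x (π↓ x ∧ y) (∧-inClass (π↓.inClass x) y∼x) (∧-lowerˡ (π↓ x) y))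
               (∧-lowerʳ (π↓ x) y)

  π↓-cong : ∀ {x y} → x ∼ y → π↓ x ≈ π↓ y
  π↓-cong {x} {y} x∼y = ≤L-antisym
    (π↓-lower (∼.trans (π↓.inClass y) (∼.sym x∼y)))
    (π↓-lower (∼.trans (π↓.inClass x) x∼y))

  𝐒∙π↓≈id : ∀ x → 𝐒 x ∙ π↓ x ≈ x
  𝐒∙π↓≈id x = //-rightDividesˡ (π↓ x) x

  π↓-suffix : ∀ {v w x} → v ≤L w → 𝐒 x ≈ w → π↓ (v ∙ π↓ x) ≈ π↓ x
  π↓-suffix {v} {w} {x} v≤w 𝐒x≈w = π↓-cong (∼.trans (∼.sym (class-convex u≤vu vu≤avu u∼avu)) u∼x)
    where
    u = π↓ x
    a = w ∙ v ⁻¹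

    wu≈x : w ∙ u ≈ x
    wu≈x = trans (∙-congʳ (sym 𝐒x≈w)) (𝐒∙π↓≈id x)

    avu≈x : a ∙ (v ∙ u) ≈ x
    avu≈x = trans (sym (assoc a v u)) (trans (∙-congʳ (//-rightDividesˡ v w)) wu≈x)

    additive : ℓ a + (ℓ v + ℓ u) ≡ ℓ (a ∙ (v ∙ u))
    additive = begin
      ℓ a + (ℓ v + ℓ u)   ≡⟨ +-assoc (ℓ a) (ℓ v) (ℓ u) ⟨
      ℓ a + ℓ v + ℓ u     ≡⟨ ≡.cong (_+ ℓ u) (≤L⇒additive (//-rightDividesˡ v w) v≤w) ⟩
      -- Being least in the class of `x`, `u` lies below `x` itself, so the factorization `w ∙ u` of
      -- `x` is length-additive.
      ℓ w + ℓ u           ≡⟨ ≤L⇒additive wu≈x (π↓-lower ∼.refl) ⟩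
      ℓ x                 ≡⟨ ℓ-cong avu≈x ⟨
      ℓ (a ∙ (v ∙ u))     ∎
      where open ≡.≡-Reasoning

    u≤vu : u ≤L v ∙ u
    u≤vu = additive⇒suffix≤L {a} additive

    vu≤avu : v ∙ u ≤L a ∙ (v ∙ u)
    vu≤avu = additive⇒suffix∙≤L {a} additive

    u∼x : u ∼ x
    u∼x = π↓.inClass x

    u∼avu : u ∼ (a ∙ (v ∙ u))
    u∼avu = ∼.trans u∼x (≈⇒∼ (sym avu≈x))

  𝐒-fibre-injection : ∀ {v w} → v ≤L w → Injection (Preimage C 𝐒 w) (Preimage C 𝐒 v)
  𝐒-fibre-injection {v} {w} v≤w = record
    { to        = λ (x , 𝐒x≈w) → v ∙ π↓ x , 𝐒vπ↓x≈v 𝐒x≈w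
    ; cong      = λ x≈y → ∙-congˡ (π↓-cong (≈⇒∼ x≈y))
    -- A point of the fibre is recovered from its two factors: `𝐒 x` is `w` throughout the fibre,
    -- and `π↓ x` is read off the image by cancelling `v`.
    ; injective = λ {(x , 𝐒x≈w)} {(y , 𝐒y≈w)} vπ↓x≈vπ↓y → begin
        x             ≈⟨ 𝐒∙π↓≈id x ⟨
        𝐒 x ∙ π↓ x    ≈⟨ ∙-cong (trans 𝐒x≈w (sym 𝐒y≈w)) (∙-cancelˡ v _ _ vπ↓x≈vπ↓y) ⟩
        𝐒 y ∙ π↓ y    ≈⟨ 𝐒∙π↓≈id y ⟩
        y             ∎
    }
    where
    open SetoidReasoning setoid

    𝐒vπ↓x≈v : ∀ {x} → 𝐒 x ≈ w → 𝐒 (v ∙ π↓ x) ≈ v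
    𝐒vπ↓x≈v {x} 𝐒x≈w =
      -- As `v ∙ π↓ x` keeps the representative `π↓ x`, sorting it strips exactly that factor and
      -- leaves `v`.
      trans (∙-congˡ (⁻¹-cong (π↓-suffix v≤w 𝐒x≈w))) (//-rightDividesʳ (π↓ x) v)

theorem4p4 : ∀ {c e s r} (C : CoxeterSystem c e s) → let open CoxeterSystem C using (Carrier) in
    (ℓ : Carrier → ℕ) → IsLengthFunction C ℓ →
    let _≤L_ = LeftWeakOrder C ℓ in
    (_∧_ : Op₂ Carrier) → Infimum _≤L_ _∧_ →
    (_∼_ : Rel Carrier r) → IsSemilatticeCongruence C _∧_ _∼_ → IsEssential C _∼_ →
    (π↓ : Op₁ Carrier) → (∀ w → IsMinimalInClass C _≤L_ _∼_ w (π↓ w)) →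
    let 𝐒 = stackSort C π↓ in
    (v w : Carrier) → v ≤L w →
    ∣ Preimage C 𝐒 v ∣≥∣ Preimage C 𝐒 w ∣
theorem4p4 C ℓ isLength _∧_ infimum _∼_ isCongruence _ π↓ π↓-minimal _ _ =
  Congruence.𝐒-fibre-injection C ℓ isLength _∧_ infimum _∼_ isCongruence π↓ π↓-minimal
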